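{- Let $m\ge 2$ and let $A$ be a symmetric $2m\times 2m$ $(0,1)$-matrix with zero diagonal (the adjacency matrix of a graph on $2m$ vertices). Partition $A$ into $2\times 2$ blocks and write $A_{i,j}$ ($1\le i,j\le m$) for the $(i,j)$-th block, so that $A_{j,i}=A_{i,j}^T$. Let $$X_1=\begin{bmatrix}-1&1\\ 1&-1\\ 1&1\\ 1&1\end{bmatrix}=\begin{bmatrix}J-2I\\ J\end{bmatrix},$$ where $J$ and $I$ are the $2\times 2$ all-ones and identity matrices, and for $i=1,\dots,m-1$ let $$M_i=\begin{bmatrix}A_{i,i}&A_{i,i+1}\\ A_{i,i+1}^T&A_{i+1,i+1}\end{bmatrix}.$$ Then $\frac14 X_1^TM_iX_1$ is a $(0,1)$-matrix for every $i=1,\dots,m-1$ if and only if both of the following hold: (a) either $A_{1,1}=A_{2,2}=\cdots=A_{m,m}=\begin{bmatrix}0&0\\0&0\end{bmatrix}$, or $A_{1,1}=A_{2,2}=\cdots=A_{m,m}=\begin{bmatrix}0&1\\1&0\end{bmatrix}$; (b) for each $i=1,\dots,m-1$, the block $A_{i,i+1}$ is one of the six matrices $$\begin{bmatrix}0&0\\0&0\end{bmatrix},\ \begin{bmatrix}1&0\\1&0\end{bmatrix},\ \begin{bmatrix}1&0\\0&1\end{bmatrix},\ \begin{bmatrix}1&1\\1&1\end{bmatrix},\ \begin{bmatrix}0&1\\0&1\end{bmatrix},\ \begin{bmatrix}0&1\\1&0\end{bmatrix}.$$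
   Context: A $(0,1)$-matrix is a matrix all of whose entries are $0$ or $1$. The matrix $X_1$ records the $2\times 2$-block structure relevant to the regular rational orthogonal matrix of level two $Q_{2m}=\frac12\,(\text{block matrix with } J-2I \text{ on the diagonal blocks, } J \text{ on blocks } (i+1,i) \text{ and on block } (1,m), \text{ zero elsewhere})$. -}

module Defs where

open import Data.Nat using (ℕ; zero; suc; _*_)
open import Data.Fin using (Fin; zero; suc; combine)
open import Data.Integer using (ℤ; +_; -[1+_]) renaming (_+_ to _+ℤ_; _*_ to _*ℤ_)
open import Data.Sum using (_⊎_)
open import Relation.Binary.PropositionalEquality using (_≡_)

Mat : ℕ → Set
Mat n = Fin n → Fin n → ℤ

sumFin : (n : ℕ) → (Fin n → ℤ) → ℤ
sumFin zero    f = + 0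
sumFin (suc n) f = f zero +ℤ sumFin n (λ k → f (suc k))

IsZeroOne : ∀ {n} → Mat n → Set
IsZeroOne {n} A = ∀ (p q : Fin n) → (A p q ≡ + 0) ⊎ (A p q ≡ + 1)

IsSymmetric : ∀ {n} → Mat n → Set
IsSymmetric {n} A = ∀ (p q : Fin n) → A p q ≡ A q p

ZeroDiagonal : ∀ {n} → Mat n → Set
ZeroDiagonal {n} A = ∀ (p : Fin n) → A p p ≡ + 0

-- the (i,j)-th 2×2 block of a (m·2)×(m·2) matrix: rows 2i, 2i+1 and columns 2j, 2j+1
block : ∀ {m} → Mat (m * 2) → Fin m → Fin m → Mat 2
block A i j a b = A (combine i a) (combine j b)

mk2 : ℤ → ℤ → ℤ → ℤ → Mat 2
mk2 a b c d zero    zero    = a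
mk2 a b c d zero    (suc _) = b
mk2 a b c d (suc _) zero    = c
mk2 a b c d (suc _) (suc _) = d

_≐_ : ∀ {n} → Mat n → Mat n → Set
_≐_ {n} B C = ∀ (p q : Fin n) → B p q ≡ C p q
infix 4 _≐_

transpose : ∀ {n} → Mat n → Mat n
transpose B p q = B q p

blocks4 : Mat 2 → Mat 2 → Mat 2 → Mat 2 → Mat 4
blocks4 P Q R S zero                   zero                   = P zero zero
blocks4 P Q R S zero                   (suc zero)             = P zero (suc zero)
blocks4 P Q R S zero                   (suc (suc zero))       = Q zero zero
blocks4 P Q R S zero                   (suc (suc (suc zero))) = Q zero (suc zero)
blocks4 P Q R S (suc zero)             zero                   = P (suc zero) zero
blocks4 P Q R S (suc zero)             (suc zero)             = P (suc zero) (suc zero)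
blocks4 P Q R S (suc zero)             (suc (suc zero))       = Q (suc zero) zero
blocks4 P Q R S (suc zero)             (suc (suc (suc zero))) = Q (suc zero) (suc zero)
blocks4 P Q R S (suc (suc zero))       zero                   = R zero zero
blocks4 P Q R S (suc (suc zero))       (suc zero)             = R zero (suc zero)
blocks4 P Q R S (suc (suc zero))       (suc (suc zero))       = S zero zero
blocks4 P Q R S (suc (suc zero))       (suc (suc (suc zero))) = S zero (suc zero)
blocks4 P Q R S (suc (suc (suc zero))) zero                   = R (suc zero) zero
blocks4 P Q R S (suc (suc (suc zero))) (suc zero)             = R (suc zero) (suc zero)
blocks4 P Q R S (suc (suc (suc zero))) (suc (suc zero))       = S (suc zero) zero
blocks4 P Q R S (suc (suc (suc zero))) (suc (suc (suc zero))) = S (suc zero) (suc zero)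

-- M_i = [[A_{i,i}, A_{i,i+1}], [A_{i,i+1}^T, A_{i+1,i+1}]], with j the index of block i+1
Mblk : ∀ {m} → Mat (m * 2) → Fin m → Fin m → Mat 4
Mblk A i j = blocks4 (block A i i) (block A i j) (transpose (block A i j)) (block A j j)

X₁ : Fin 4 → Fin 2 → ℤ
X₁ zero                   zero    = -[1+ 0 ]
X₁ zero                   (suc _) = + 1
X₁ (suc zero)             zero    = + 1
X₁ (suc zero)             (suc _) = -[1+ 0 ]
X₁ (suc (suc _))          _       = + 1

XtMX : Mat 4 → Mat 2
XtMX M r s = sumFin 4 (λ p → sumFin 4 (λ q → X₁ p r *ℤ M p q *ℤ X₁ q s))

QuarterIsZeroOne : Mat 2 → Set
QuarterIsZeroOne B = ∀ (r s : Fin 2) → (B r s ≡ + 0) ⊎ (B r s ≡ + 4)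

O₂ K₂ : Mat 2
O₂ = mk2 (+ 0) (+ 0) (+ 0) (+ 0)
K₂ = mk2 (+ 0) (+ 1) (+ 1) (+ 0)

AllowedOffDiag : Mat 2 → Set
AllowedOffDiag B =
  (B ≐ mk2 (+ 0) (+ 0) (+ 0) (+ 0)) ⊎
  (B ≐ mk2 (+ 1) (+ 0) (+ 1) (+ 0)) ⊎
  (B ≐ mk2 (+ 1) (+ 0) (+ 0) (+ 1)) ⊎
  (B ≐ mk2 (+ 1) (+ 1) (+ 1) (+ 1)) ⊎
  (B ≐ mk2 (+ 0) (+ 1) (+ 0) (+ 1)) ⊎
  (B ≐ mk2 (+ 0) (+ 1) (+ 1) (+ 0))

{-# OPTIONS --safe #-}

-- Write the diagonal blocks of Mᵢ as x K₂ and y K₂, and let δ be the second row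
-- sum of A_{i,i+1} minus the first.  Then X₁ᵀ Mᵢ X₁ has off-diagonal entries
-- 2 (x + y) and diagonal entries 2 (y - x ± δ).  The former lie in {0, 4} only if
-- x = y; the diagonal entries are then opposite, so they lie in {0, 4} only if
-- δ = 0.  The six listed blocks are the (0,1)-blocks with equal row sums.
module Submission where

open import Defs
open import Data.Nat using (ℕ; zero; suc; _≤_; _*_)
open import Data.Fin using (Fin; zero; suc; toℕ; combine; quotient; remainder)
open import Data.Fin.Patterns using (0F; 1F; 2F; 3F)
open import Data.Integer using (ℤ; +_; -[1+_]) renaming (_+_ to _+ℤ_; _-_ to _-ℤ_; _*_ to _*ℤ_)
open import Data.Integer.Properties using (*-cancelˡ-≡; i-j≡0⇒i≡j; i≡j⇒i-j≡0)
open import Data.Integer.Solver using (module +-*-Solver)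
open import Data.Vec using (Vec; tabulate)
open import Data.Integer.Tactic.RingSolver using (solve-∀)
open import Data.Sum using (_⊎_; inj₁; inj₂) renaming (map to ⊎-map)
open import Data.Product using (_×_; _,_)
open import Relation.Binary.PropositionalEquality using (_≡_; refl; sym; trans; cong; cong₂; subst)
open import Function.Base using (_∘_)
open import Function.Bundles using (_⇔_; mk⇔)

-- (0,1)-blocks with equal row sums

IsBit : ℤ → Set
IsBit x = (x ≡ + 0) ⊎ (x ≡ + 1)

IsQuarterBit : ℤ → Set
IsQuarterBit x = (x ≡ + 0) ⊎ (x ≡ + 4)

≐-mk2 : ∀ {B : Mat 2} {a b c d} →
  B 0F 0F ≡ a → B 0F 1F ≡ b → B 1F 0F ≡ c → B 1F 1F ≡ d → B ≐ mk2 a b c d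
≐-mk2 p q r s 0F 0F = p
≐-mk2 p q r s 0F 1F = q
≐-mk2 p q r s 1F 0F = r
≐-mk2 p q r s 1F 1F = s

EqualRowSums : Mat 2 → Set
EqualRowSums B = B 0F 0F +ℤ B 0F 1F ≡ B 1F 0F +ℤ B 1F 1F

-- The entries are separate variables so that each bit proof can be matched with `refl`. The sum
-- equation then relates numerals: it holds in six of the sixteen cases, listed first in the order
-- of `AllowedOffDiag`, and is absurd in the other ten.
bits-equalRowSums⇒allowed : ∀ {B a b c d} → IsBit a → IsBit b → IsBit c → IsBit d →
  a +ℤ b ≡ c +ℤ d → B ≐ mk2 a b c d → AllowedOffDiag B
bits-equalRowSums⇒allowed (inj₁ refl) (inj₁ refl) (inj₁ refl) (inj₁ refl) _ B≐ = inj₁ B≐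
bits-equalRowSums⇒allowed (inj₂ refl) (inj₁ refl) (inj₂ refl) (inj₁ refl) _ B≐ = inj₂ (inj₁ B≐)
bits-equalRowSums⇒allowed (inj₂ refl) (inj₁ refl) (inj₁ refl) (inj₂ refl) _ B≐ = inj₂ (inj₂ (inj₁ B≐))
bits-equalRowSums⇒allowed (inj₂ refl) (inj₂ refl) (inj₂ refl) (inj₂ refl) _ B≐ = inj₂ (inj₂ (inj₂ (inj₁ B≐)))
bits-equalRowSums⇒allowed (inj₁ refl) (inj₂ refl) (inj₁ refl) (inj₂ refl) _ B≐ = inj₂ (inj₂ (inj₂ (inj₂ (inj₁ B≐))))
bits-equalRowSums⇒allowed (inj₁ refl) (inj₂ refl) (inj₂ refl) (inj₁ refl) _ B≐ = inj₂ (inj₂ (inj₂ (inj₂ (inj₂ B≐))))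
bits-equalRowSums⇒allowed (inj₁ refl) (inj₁ refl) (inj₁ refl) (inj₂ refl) ()
bits-equalRowSums⇒allowed (inj₁ refl) (inj₁ refl) (inj₂ refl) (inj₁ refl) ()
bits-equalRowSums⇒allowed (inj₁ refl) (inj₁ refl) (inj₂ refl) (inj₂ refl) ()
bits-equalRowSums⇒allowed (inj₁ refl) (inj₂ refl) (inj₁ refl) (inj₁ refl) ()
bits-equalRowSums⇒allowed (inj₁ refl) (inj₂ refl) (inj₂ refl) (inj₂ refl) ()
bits-equalRowSums⇒allowed (inj₂ refl) (inj₁ refl) (inj₁ refl) (inj₁ refl) ()
bits-equalRowSums⇒allowed (inj₂ refl) (inj₁ refl) (inj₂ refl) (inj₂ refl) ()
bits-equalRowSums⇒allowed (inj₂ refl) (inj₂ refl) (inj₁ refl) (inj₁ refl) ()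
bits-equalRowSums⇒allowed (inj₂ refl) (inj₂ refl) (inj₁ refl) (inj₂ refl) ()
bits-equalRowSums⇒allowed (inj₂ refl) (inj₂ refl) (inj₂ refl) (inj₁ refl) ()

equalRowSums⇒allowed : ∀ {B} → IsZeroOne B → EqualRowSums B → AllowedOffDiag B
equalRowSums⇒allowed 01B sums = bits-equalRowSums⇒allowed
  (01B 0F 0F) (01B 0F 1F) (01B 1F 0F) (01B 1F 1F) sums (≐-mk2 refl refl refl refl)

allowed⇒equalRowSums : ∀ {B} → AllowedOffDiag B → EqualRowSums B
allowed⇒equalRowSums {B} = λ where
    (inj₁ B≐)                             → via B≐ refl
    (inj₂ (inj₁ B≐))                      → via B≐ refl
    (inj₂ (inj₂ (inj₁ B≐)))               → via B≐ refl
    (inj₂ (inj₂ (inj₂ (inj₁ B≐))))        → via B≐ refl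
    (inj₂ (inj₂ (inj₂ (inj₂ (inj₁ B≐))))) → via B≐ refl
    (inj₂ (inj₂ (inj₂ (inj₂ (inj₂ B≐))))) → via B≐ refl
  where
  via : ∀ {a b c d} → B ≐ mk2 a b c d → a +ℤ b ≡ c +ℤ d → EqualRowSums B
  via B≐ eq = trans (cong₂ _+ℤ_ (B≐ 0F 0F) (B≐ 0F 1F))
             (trans eq (sym (cong₂ _+ℤ_ (B≐ 1F 0F) (B≐ 1F 1F))))

-- Entries of `XtMX M` for a general `M`

rowDefect : Mat 2 → ℤ
rowDefect B = (B 1F 0F +ℤ B 1F 1F) -ℤ (B 0F 0F +ℤ B 0F 1F)

sign : Fin 2 → ℤ
sign = X₁ 0F

-- The upper half of column r of X₁ is sign r · (1, -1), the lower half is (1, 1).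
XtMX-expand : ∀ M r s → XtMX M r s ≡
  sign r *ℤ sign s *ℤ (M 0F 0F +ℤ M 1F 1F -ℤ (M 0F 1F +ℤ M 1F 0F))
    +ℤ sign r *ℤ (M 0F 2F +ℤ M 0F 3F -ℤ (M 1F 2F +ℤ M 1F 3F))
    +ℤ sign s *ℤ (M 2F 0F +ℤ M 3F 0F -ℤ (M 2F 1F +ℤ M 3F 1F))
    +ℤ (M 2F 2F +ℤ M 3F 3F +ℤ (M 2F 3F +ℤ M 3F 2F))
XtMX-expand M = λ where
    -- Fixing `r` and `s` turns the coefficients into numerals, leaving a linear identity in the
    -- sixteen entries of `M`.
    0F 0F → prove entries (lhs 0F 0F) (rhs 0F 0F) refl
    0F 1F → prove entries (lhs 0F 1F) (rhs 0F 1F) refl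
    1F 0F → prove entries (lhs 1F 0F) (rhs 1F 0F) refl
    1F 1F → prove entries (lhs 1F 1F) (rhs 1F 1F) refl
  where
  open +-*-Solver

  -- `quotient` and `remainder` undo `combine`, so the variable with index `combine p q` stands for
  -- `M p q`.
  entries : Vec ℤ 16
  entries = tabulate (λ k → M (quotient {4} 4 k) (remainder {4} 4 k))

  m : Fin 4 → Fin 4 → Polynomial 16
  m p q = var (combine p q)

  -- Follows `sumFin` clause by clause, final zero included, so that `lhs r s` evaluates to
  -- `XtMX M r s` by computation.
  sumPoly : ∀ n → (Fin n → Polynomial 16) → Polynomial 16
  sumPoly zero    f = con (+ 0)
  sumPoly (suc n) f = f zero :+ sumPoly n (f ∘ suc)

  lhs rhs : Fin 2 → Fin 2 → Polynomial 16
  lhs r s = sumPoly 4 λ p → sumPoly 4 λ q → con (X₁ p r) :* m p q :* con (X₁ q s)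
  rhs r s =
    con (sign r) :* con (sign s) :* (m 0F 0F :+ m 1F 1F :- (m 0F 1F :+ m 1F 0F))
      :+ con (sign r) :* (m 0F 2F :+ m 0F 3F :- (m 1F 2F :+ m 1F 3F))
      :+ con (sign s) :* (m 2F 0F :+ m 3F 0F :- (m 2F 1F :+ m 3F 1F))
      :+ (m 2F 2F :+ m 3F 3F :+ (m 2F 3F :+ m 3F 2F))

-- One pair of consecutive diagonal blocks

module _ (P Q S : Mat 2) (x y : ℤ)
         (P≐ : P ≐ mk2 (+ 0) x x (+ 0)) (S≐ : S ≐ mk2 (+ 0) y y (+ 0)) where

  private
    B : Mat 2
    B = XtMX (blocks4 P Q (transpose Q) S)

    δ : ℤ
    δ = rowDefect Q

  -- The lower left block is the transpose of `Q`, so both off-diagonal blocks yield `-δ`, weighted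
  -- by `sign r` and `sign s`. The block `P` yields `-2x`, weighted by the product of the signs, and
  -- `S` yields `2y`.
  entry : ∀ r s → B r s ≡ + 2 *ℤ (y -ℤ sign r *ℤ sign s *ℤ x) -ℤ (sign r +ℤ sign s) *ℤ δ
  entry r s
    rewrite XtMX-expand (blocks4 P Q (transpose Q) S) r s
          | P≐ 0F 0F | P≐ 0F 1F | P≐ 1F 0F | P≐ 1F 1F
          | S≐ 0F 0F | S≐ 0F 1F | S≐ 1F 0F | S≐ 1F 1F
          = collect (sign r) (sign s) x y (Q 0F 0F) (Q 0F 1F) (Q 1F 0F) (Q 1F 1F)
    where
    collect : ∀ u v x y a b c d →
      u *ℤ v *ℤ (+ 0 +ℤ + 0 -ℤ (x +ℤ x)) +ℤ u *ℤ (a +ℤ b -ℤ (c +ℤ d))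
        +ℤ v *ℤ (a +ℤ b -ℤ (c +ℤ d)) +ℤ (+ 0 +ℤ + 0 +ℤ (y +ℤ y))
      ≡ + 2 *ℤ (y -ℤ u *ℤ v *ℤ x) -ℤ (u +ℤ v) *ℤ ((c +ℤ d) -ℤ (a +ℤ b))
    collect = solve-∀

  entry₀₀ : B 0F 0F ≡ + 2 *ℤ (y -ℤ x +ℤ δ)
  entry₀₀ = trans (entry 0F 0F) (simplify x y δ)
    where
    -- Both signs are -1 here, so their product is 1 and their sum is -2.
    simplify : ∀ x y d →
      + 2 *ℤ (y -ℤ + 1 *ℤ x) -ℤ -[1+ 1 ] *ℤ d ≡ + 2 *ℤ (y -ℤ x +ℤ d)
    simplify = solve-∀

  -- Opposite signs have sum 0, which removes `δ`, and product -1, which turns the difference of `y`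
  -- and `x` into a sum.
  entry₀₁ : B 0F 1F ≡ + 2 *ℤ (x +ℤ y)
  entry₀₁ = trans (entry 0F 1F) (simplify x y δ)
    where
    simplify : ∀ x y d → + 2 *ℤ (y -ℤ -[1+ 0 ] *ℤ x) -ℤ + 0 *ℤ d ≡ + 2 *ℤ (x +ℤ y)
    simplify = solve-∀

  entry₁₀ : B 1F 0F ≡ + 2 *ℤ (x +ℤ y)
  -- The formula of `entry` is symmetric in the two signs, and at these numerals both instances
  -- compute to the same expression.
  entry₁₀ = trans (entry 1F 0F) (trans (sym (entry 0F 1F)) entry₀₁)

  entry₁₁ : B 1F 1F ≡ + 2 *ℤ (y -ℤ x -ℤ δ)
  entry₁₁ = trans (entry 1F 1F) (simplify x y δ)
    where
    simplify : ∀ x y d → + 2 *ℤ (y -ℤ + 1 *ℤ x) -ℤ + 2 *ℤ d ≡ + 2 *ℤ (y -ℤ x -ℤ d)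
    simplify = solve-∀

  -- If exactly one bit were 1, the off-diagonal entry would be 2, which is neither 0 nor 4.
  quarterBits⇒≡ : IsBit x → IsBit y → QuarterIsZeroOne B → x ≡ y
  quarterBits⇒≡ bx by quarter =
    cases bx by (subst IsQuarterBit entry₀₁ (quarter 0F 1F))
    where
    cases : ∀ {x y} → IsBit x → IsBit y → IsQuarterBit (+ 2 *ℤ (x +ℤ y)) → x ≡ y
    cases (inj₁ refl) (inj₁ refl) _ = refl
    cases (inj₂ refl) (inj₂ refl) _ = refl
    cases (inj₁ refl) (inj₂ refl) (inj₁ ())
    cases (inj₁ refl) (inj₂ refl) (inj₂ ())
    cases (inj₂ refl) (inj₁ refl) (inj₁ ())
    cases (inj₂ refl) (inj₁ refl) (inj₂ ())

  -- For `x = y` the diagonal entries are `2δ` and `-2δ`. Each is 0 or 4 and they sum to 0, so the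
  -- first vanishes; cancelling the factor 2 gives `δ = 0`.
  quarterBits⇒equalRowSums : x ≡ y → QuarterIsZeroOne B → EqualRowSums Q
  quarterBits⇒equalRowSums refl quarter = sym (i-j≡0⇒i≡j _ _ δ≡0)
    where
    opposite : ∀ x d → + 2 *ℤ (x -ℤ x +ℤ d) +ℤ + 2 *ℤ (x -ℤ x -ℤ d) ≡ + 0
    opposite = solve-∀

    cancel : ∀ x d → x -ℤ x +ℤ d ≡ d
    cancel = solve-∀

    nonneg-opposite : ∀ {i j} → IsQuarterBit i → IsQuarterBit j → i +ℤ j ≡ + 0 → i ≡ + 0
    nonneg-opposite (inj₁ i≡0)  _           _  = i≡0
    nonneg-opposite (inj₂ refl) (inj₁ refl) ()
    nonneg-opposite (inj₂ refl) (inj₂ refl) ()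

    B₀₀≡0 : B 0F 0F ≡ + 0
    B₀₀≡0 = nonneg-opposite (quarter 0F 0F) (quarter 1F 1F)
      (trans (cong₂ _+ℤ_ entry₀₀ entry₁₁) (opposite x δ))

    δ≡0 : δ ≡ + 0
    δ≡0 = trans (sym (cancel x δ))
      (*-cancelˡ-≡ (+ 2) _ _ (trans (sym entry₀₀) B₀₀≡0))

  -- The diagonal entries vanish together with `δ`; the off-diagonal ones equal `4x`, with `x` a
  -- bit.
  equal⇒quarterBits : IsBit x → x ≡ y → EqualRowSums Q → QuarterIsZeroOne B
  equal⇒quarterBits bx refl sums = λ where
      0F 0F → inj₁ (trans entry₀₀ (trans (cong (λ d → + 2 *ℤ (x -ℤ x +ℤ d)) δ≡0) (vanish₊ x)))
      0F 1F → subst IsQuarterBit (sym entry₀₁) (cases bx)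
      1F 0F → subst IsQuarterBit (sym entry₁₀) (cases bx)
      1F 1F → inj₁ (trans entry₁₁ (trans (cong (λ d → + 2 *ℤ (x -ℤ x -ℤ d)) δ≡0) (vanish₋ x)))
    where
    δ≡0 : δ ≡ + 0
    δ≡0 = i≡j⇒i-j≡0 (sym sums)

    vanish₊ : ∀ x → + 2 *ℤ (x -ℤ x +ℤ + 0) ≡ + 0
    vanish₊ = solve-∀

    vanish₋ : ∀ x → + 2 *ℤ (x -ℤ x -ℤ + 0) ≡ + 0
    vanish₋ = solve-∀

    cases : ∀ {x} → IsBit x → IsQuarterBit (+ 2 *ℤ (x +ℤ x))
    cases (inj₁ refl) = inj₁ refl
    cases (inj₂ refl) = inj₂ refl

-- From consecutive blocks to the whole matrix

constant : ∀ {a} {A : Set a} {n} (f : Fin (suc n) → A) →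
  (∀ i j → toℕ j ≡ suc (toℕ i) → f i ≡ f j) → ∀ i → f zero ≡ f i
constant         f step zero    = refl
-- An index `suc i` forces `n` to be a successor, so `1F` exists: one step leads from 0 to 1, and
-- the induction continues with `f ∘ suc`.
constant {n = suc _} f step (suc i) = trans (step zero 1F refl)
  (constant (f ∘ suc) (λ i j eq → step (suc i) (suc j) (cong suc eq)) i)

module _ {n} (A : Mat (suc n * 2)) (01A : IsZeroOne A) (symA : IsSymmetric A)
         (zeroDiag : ZeroDiagonal A) where

  private
    x : Fin (suc n) → ℤ
    x i = block A i i 0F 1F

    Quarters Diagonal OffDiagonal : Set
    Quarters = ∀ (i j : Fin (suc n)) → toℕ j ≡ suc (toℕ i) → QuarterIsZeroOne (XtMX (Mblk A i j))
    Diagonal = (∀ (i : Fin (suc n)) → block A i i ≐ O₂) ⊎ (∀ (i : Fin (suc n)) → block A i i ≐ K₂)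
    OffDiagonal = ∀ (i j : Fin (suc n)) → toℕ j ≡ suc (toℕ i) → AllowedOffDiag (block A i j)

  bit : ∀ (i : Fin (suc n)) → IsBit (x i)
  bit i = 01A (combine i 0F) (combine i 1F)

  -- A diagonal block inherits symmetry and zero diagonal from `A`, so a single bit determines it.
  hollow : ∀ (i : Fin (suc n)) → block A i i ≐ mk2 (+ 0) (x i) (x i) (+ 0)
  hollow i = ≐-mk2 (zeroDiag (combine i 0F)) refl
    (symA (combine i 1F) (combine i 0F)) (zeroDiag (combine i 1F))

  consecutive-≡ : Quarters → ∀ (i j : Fin (suc n)) → toℕ j ≡ suc (toℕ i) → x i ≡ x j
  consecutive-≡ quarters i j eq =
    quarterBits⇒≡ (block A i i) (block A i j) (block A j j) (x i) (x j)
      (hollow i) (hollow j) (bit i) (bit j) (quarters i j eq)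

  -- The bit of the first block selects the alternative. Since `O₂` and `K₂` are
  -- `mk2 (+ 0) c c (+ 0)` for `c` equal to 0 and 1, `all≐` serves both.
  constant⇒diagonal : (∀ (i : Fin (suc n)) → x zero ≡ x i) → Diagonal
  constant⇒diagonal const = ⊎-map all≐ all≐ (bit zero)
    where
    all≐ : ∀ {c} → x zero ≡ c → ∀ (i : Fin (suc n)) → block A i i ≐ mk2 (+ 0) c c (+ 0)
    all≐ x₀≡c i = subst (λ c → block A i i ≐ mk2 (+ 0) c c (+ 0))
      (trans (sym (const i)) x₀≡c) (hollow i)

  diagonal⇒≡ : Diagonal → ∀ (i j : Fin (suc n)) → x i ≡ x j
  diagonal⇒≡ (inj₁ O) i j = trans (O i 0F 1F) (sym (O j 0F 1F))
  diagonal⇒≡ (inj₂ K) i j = trans (K i 0F 1F) (sym (K j 0F 1F))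

  quarters⇒diagonal : Quarters → Diagonal
  quarters⇒diagonal quarters = constant⇒diagonal (constant x (consecutive-≡ quarters))

  quarters⇒offDiagonal : Quarters → OffDiagonal
  quarters⇒offDiagonal quarters i j eq =
    equalRowSums⇒allowed (λ p q → 01A (combine i p) (combine j q))
      (quarterBits⇒equalRowSums (block A i i) (block A i j) (block A j j) (x i) (x j)
        (hollow i) (hollow j) (consecutive-≡ quarters i j eq) (quarters i j eq))

  diagonal∧offDiagonal⇒quarters : Diagonal → OffDiagonal → Quarters
  diagonal∧offDiagonal⇒quarters diag allowed i j eq =
    equal⇒quarterBits (block A i i) (block A i j) (block A j j) (x i) (x j)
      (hollow i) (hollow j) (bit i) (diagonal⇒≡ diag i j)
      (allowed⇒equalRowSums (allowed i j eq))

theorem3p2 : (m : ℕ) → 2 ≤ m → (A : Mat (m * 2)) →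
    IsZeroOne A → IsSymmetric A → ZeroDiagonal A →
    ((∀ (i j : Fin m) → toℕ j ≡ suc (toℕ i) → QuarterIsZeroOne (XtMX (Mblk A i j)))
    ⇔
    (((∀ (i : Fin m) → block A i i ≐ O₂) ⊎ (∀ (i : Fin m) → block A i i ≐ K₂)) ×
    (∀ (i j : Fin m) → toℕ j ≡ suc (toℕ i) → AllowedOffDiag (block A i j))))
-- The bound `2 ≤ m` excludes `m = 0`; the successor form provides the first block, whose bit
-- decides between the alternatives in (a).
theorem3p2 (suc _) _ A 01A symA zeroDiag = mk⇔
  (λ quarters → quarters⇒diagonal A 01A symA zeroDiag quarters
              , quarters⇒offDiagonal A 01A symA zeroDiag quarters)
  (λ (diag , allowed) → diagonal∧offDiagonal⇒quarters A 01A symA zeroDiag diag allowed)
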